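{- Let $U$ be an undirected graph, and for every $e\in E(U)$ let $(a_e,b_e,r_e,q_e)$ be a tuple of integers with $q_e\ge 2$ and $\gcd(a_e,q_e)=\gcd(b_e,q_e)=1$. Then there exists an integer $M$ such that the following holds. For every undirected graph $G$ and all sets $B_1,B_2\subseteq E(G)$ with $\mu^*(G,B_1,B_2)\ge M$, the graph $G$ contains a subdivision of $U$ such that for every $e\in E(U)$, the branching path $P_e$ of this subdivision corresponding to $e$ satisfies $$a_e\,|E(P_e)\cap B_1|+b_e\,|E(P_e)\cap B_2|\equiv r_e\pmod{q_e}.$$
   Context: All undirected graphs are finite and simple; $E(G)$ denotes the edge set of $G$. For an undirected graph $G$ and $B_1,B_2\subseteq E(G)$ (not necessarily disjoint), a cycle $C$ of $G$ is called $(B_1,B_2)$-unbalanced if $|E(C)\cap B_1|\neq|E(C)\cap B_2|$. $\mu^*(G,B_1,B_2)$ denotes the minimum number of parts in a partition $\mathcal{P}$ of $V(G)$ such that for every $P\in\mathcal{P}$ the subgraph $G[P]$ of $G$ induced by $P$ contains no $(B_1,B_2)$-unbalanced cycle. A subdivision of $U$ is a graph obtained from $U$ by replacing edges of $U$ by pairwise internally vertex-disjoint paths (with new internal vertices) joining the same endpoints; the branching path $P_e$ corresponding to an edge $e$ is the path replacing $e$ (or $e$ itself, viewed as a path of length 1, if it is not replaced). "$G$ contains a subdivision of $U$" means that some subgraph of $G$ is isomorphic to a subdivision of $U$. -}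

module Defs where

open import Data.Fin using (Fin; _<_)
open import Data.Fin.Properties using (_<?_; <-irrefl)
open import Data.Integer as ℤ using (ℤ)
open import Data.Integer.Divisibility using (_∣_)
open import Data.List using (List; []; _∷_; [_]; _++_; _∷ʳ_; map; filter; length; allFin)
open import Data.List.Membership.Propositional using (_∈_)
open import Data.List.Membership.Propositional.Properties using (∈-map⁻; ∈-++⁻)
open import Data.List.Relation.Unary.All as All using (All; []; _∷_)
open import Data.List.Relation.Unary.AllPairs using ([]; _∷_)
open import Data.List.Relation.Unary.Any using (here; there)
open import Data.List.Relation.Unary.Linked using (Linked)
open import Data.List.Relation.Unary.Unique.Propositional using (Unique)
open import Data.List.Relation.Unary.Unique.Propositional.Properties using (map⁺; ++⁺; allFin⁺)
open import Data.Nat using (ℕ; _≤_)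
open import Data.Product using (Σ; ∃; _×_; _,_; uncurry)
open import Data.Sum using (_⊎_; inj₁; inj₂; swap)
open import Data.Sum.Properties using (inj₁-injective)
open import Function.Definitions using (Injective; Surjective)
open import Level using (0ℓ)
open import Relation.Binary.Core using (Rel; _⇒_)
open import Relation.Binary.Definitions using (Symmetric; Irreflexive; Decidable)
open import Relation.Binary.PropositionalEquality using (_≡_; _≢_; refl)
open import Relation.Nullary using (¬_)
open import Relation.Nullary.Decidable using (recompute)

record SimpleGraph (V : Set) : Set₁ where
  field
    Adj        : Rel V 0ℓ
    adj-sym    : Symmetric Adj
    adj-irrefl : Irreflexive _≡_ Adj

record Graph : Set₁ where
  field
    order  : ℕ
    simple : SimpleGraph (Fin order)
  open SimpleGraph simple public
  field
    adj? : Decidable Adj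

  Vertex : Set
  Vertex = Fin order

-- An undirected edge is stored once, with its smaller endpoint as `src`.
-- The irrelevant fields make an edge determined by its endpoints even though
-- `Adj` need not be proof-irrelevant.
record Edge (G : Graph) : Set where
  constructor mkEdge
  open Graph G
  field
    src tgt  : Vertex
    .ordered : src < tgt
    .joined  : Adj src tgt

-- A subset of E(G), as a symmetric relation: `Mem u v` says that {u,v} is an
-- edge of G belonging to the subset.
record EdgeSet (G : Graph) : Set₁ where
  open Graph G
  field
    Mem     : Rel Vertex 0ℓ
    mem-sym : Symmetric Mem
    mem⇒adj : Mem ⇒ Adj
    mem?    : Decidable Mem

steps : {A : Set} → List A → List (A × A)
steps []           = []
steps (_ ∷ [])     = []
steps (x ∷ y ∷ xs) = (x , y) ∷ steps (y ∷ xs)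

-- |E(W) ∩ B| for a walk W given by its vertex sequence.  The count is with
-- multiplicity; it is only used for paths and cycles, whose edges are distinct.
∣E_∩_∣ : {G : Graph} → List (Graph.Vertex G) → EdgeSet G → ℕ
∣E W ∩ B ∣ = length (filter (λ e → uncurry (EdgeSet.mem? B) e) (steps W))

record Cycle (G : Graph) : Set where
  open Graph G
  field
    start    : Vertex
    rest     : List Vertex
    length≥3 : 3 ≤ length (start ∷ rest)
    distinct : Unique (start ∷ rest)
    linked   : Linked Adj (start ∷ rest ∷ʳ start)

  vertices closedWalk : List Vertex
  vertices   = start ∷ rest
  closedWalk = start ∷ rest ∷ʳ start

module _ (G : Graph) (B₁ B₂ : EdgeSet G) where
  open Graph G

  Unbalanced : Cycle G → Set
  Unbalanced C = ∣E Cycle.closedWalk C ∩ B₁ ∣ ≢ ∣E Cycle.closedWalk C ∩ B₂ ∣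

  -- The parts are the fibres of `part`, nonempty by surjectivity.  The cycles
  -- of G[P] are the cycles of G all of whose vertices lie in P.
  record BalancedPartition (k : ℕ) : Set where
    field
      part     : Vertex → Fin k
      nonempty : Surjective _≡_ _≡_ part
      balanced : ∀ i → ¬ (∃ λ (C : Cycle G) →
                   All (λ v → part v ≡ i) (Cycle.vertices C) × Unbalanced C)

  -- `Isμ* m` says that m is the minimum defining μ*(G,B₁,B₂).
  record Isμ* (m : ℕ) : Set where
    field
      attained : BalancedPartition m
      minimal  : ∀ k → BalancedPartition k → m ≤ k

-- In the subdivision of U described by ℓ, the edge e is replaced by a path with
-- ℓ e new internal vertices; ℓ e ≡ 0 leaves e unreplaced.
module _ (U : Graph) (ℓ : Edge U → ℕ) where
  open Graph U

  SubdivVertex : Set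
  SubdivVertex = Vertex ⊎ Σ (Edge U) (λ e → Fin (ℓ e))

  internal branch : Edge U → List SubdivVertex
  internal e = map (λ i → inj₂ (e , i)) (allFin (ℓ e))
  branch   e = inj₁ (Edge.src e) ∷ internal e ++ [ inj₁ (Edge.tgt e) ]

  private
    src≢tgt : (e : Edge U) → Edge.src e ≢ Edge.tgt e
    src≢tgt (mkEdge u v u<v _) u≡v = <-irrefl u≡v (recompute (u <? v) u<v)

    old∉internal : ∀ e {u} → ¬ (inj₁ u ∈ internal e)
    old∉internal e u∈ with ∈-map⁻ (λ i → inj₂ (e , i)) u∈
    ... | _ , _ , ()

    branch-unique : ∀ e → Unique (branch e)
    branch-unique e =
        All.tabulate (λ { x∈ refl → src∉ x∈ })
      ∷ ++⁺ (map⁺ (λ { refl → refl }) (allFin⁺ (ℓ e))) ([] ∷ [])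
            (λ { (t∈ , here refl) → old∉internal e t∈ })
      where
      src∉ : ¬ (inj₁ (Edge.src e) ∈ internal e ++ [ inj₁ (Edge.tgt e) ])
      src∉ s∈ with ∈-++⁻ (internal e) s∈
      ... | inj₁ s∈i       = old∉internal e s∈i
      ... | inj₂ (here eq) = src≢tgt e (inj₁-injective eq)

    steps-irrefl : {A : Set} {x : A} (xs : List A) → Unique xs → ¬ ((x , x) ∈ steps xs)
    steps-irrefl (_ ∷ _ ∷ _)  ((x≢x ∷ _) ∷ _) (here refl) = x≢x refl
    steps-irrefl (_ ∷ y ∷ xs) (_ ∷ uniq)      (there p)   = steps-irrefl (y ∷ xs) uniq p

  subdivision : SimpleGraph SubdivVertex
  subdivision = record
    { Adj        = λ x y → ∃ λ e → (x , y) ∈ steps (branch e) ⊎ (y , x) ∈ steps (branch e)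
    ; adj-sym    = λ { (e , p) → e , swap p }
    ; adj-irrefl = λ { refl (e , inj₁ p) → steps-irrefl (branch e) (branch-unique e) p
                     ; refl (e , inj₂ p) → steps-irrefl (branch e) (branch-unique e) p }
    }

-- An isomorphism of H onto a (not necessarily induced) subgraph of K.
record Embedding {W V : Set} (H : SimpleGraph W) (K : SimpleGraph V) : Set where
  field
    to        : W → V
    injective : Injective _≡_ _≡_ to
    preserves : ∀ {x y} → SimpleGraph.Adj H x y → SimpleGraph.Adj K (to x) (to y)

-- A subgraph of G isomorphic to a subdivision of U.
record SubdivisionIn (U G : Graph) : Set where
  field
    ℓ         : Edge U → ℕ
    embedding : Embedding (subdivision U ℓ) (Graph.simple G)

  branchingPath : Edge U → List (Graph.Vertex G)
  branchingPath e = map (Embedding.to embedding) (branch U ℓ e)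

infix 4 _≡_[mod_]

_≡_[mod_] : ℤ → ℤ → ℤ → Set
x ≡ y [mod q ] = q ∣ x ℤ.- y

{-# OPTIONS --safe #-}
-- A partition of V(G) that is a proper colouring both for B₁ ∖ B₂ and for B₂ ∖ B₁ has only
-- balanced parts, so if μ* is large then one of these two graphs, call it H, has large chromatic
-- number.  A path of length L in H contributes a L or b L to the congruence, and a, b are units,
-- so it suffices to find in H a subdivision of U in which the length of every branching path can
-- be chosen freely in an interval of q consecutive integers.
--
-- Breadth-first search turns a vertex set X of large chromatic number into a "fan": a subset Y
-- (one layer) still of large chromatic number and a root outside Y to which each vertex of Y has
-- a path of one fixed length through X ∖ Y.  If fans are iterated, then going first to
-- a neighbour in the previous layer lengthens a path by one, so w iterations give paths of
-- w + 1 consecutive lengths.  Three nested fans then join any two vertices of the innermost set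
-- by paths, internally outside that set, of consecutive lengths.  One does this for each edge
-- of U in turn, always inside the set just obtained, and so the paths are internally disjoint.
module Submission where

open import Defs
open import Data.Bool using (Bool; true; false; not)
open import Data.Bool.Properties using (not-¬)
open import Data.Empty using (⊥-elim)
open import Data.Fin as Fin using (Fin; zero; suc; combine; remQuot; finToFun; funToFin; punchOut)
open import Data.Fin.Properties as Fin
  using (any?; all?; _≟_; combine-injective; remQuot-combine; finToFun-funToFin; punchOut-injective)
open import Data.Fin.Subset using (Subset; _∈_; _∉_; _⊆_; _⊂_; _─_; ⁅_⁆; Nonempty) renaming (⊥ to ∅; ⊤ to full)
open import Data.Fin.Subset.Induction using (Acc; acc; ⊂-wellFounded)
open import Data.Fin.Subset.Properties
  using (_∈?_; nonempty?; x∈⁅x⁆; x∈⁅y⁆⇒x≡y; ∉⊥; ∈⊤; ⊆-refl; p─q⊆p; x∈p∧x∉q⇒x∈p─q)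
open import Data.Integer using (ℤ; +_; 1ℤ; _+_; _*_; _≤_; -_; _-_; ∣_∣; +≤+)
open import Data.Integer.DivMod using (_%ℕ_; _/ℕ_; n%ℕd<d; a≡a%ℕn+[a/ℕn]*n)
open import Data.Integer.Divisibility.Signed using (divides; ∣⇒∣ᵤ)
open import Data.Integer.GCD using (gcd)
import Data.Integer.Properties as ℤ
open import Data.Integer.Solver using (module +-*-Solver)
open import Data.List using (List; []; _∷_; _++_; _∷ʳ_; length; map; filter; allFin; lookup)
open import Data.List.Membership.DecPropositional using () renaming (_∈?_ to ∈ₗ-dec)
open import Data.List.Membership.Propositional using () renaming (_∈_ to _∈ₗ_)
open import Data.List.Membership.Propositional.Properties using (∈-++⁻; ∈-lookup)
open import Data.List.Properties
  using (length-++; map-++; map-∘; map-tabulate; tabulate-lookup; filter-all; filter-none)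
open import Data.List.Relation.Binary.Permutation.Propositional
  using (_↭_; prep; ↭-refl; ↭-sym; ↭-trans; ↭⇒↭ₛ)
open import Data.List.Relation.Binary.Permutation.Propositional.Properties
  using (∷↭∷ʳ; ↭-length; ∈-resp-↭)
import Data.List.Relation.Binary.Permutation.Setoid.Properties as Permutation
open import Data.List.Relation.Unary.All as All using (All; []; _∷_)
open import Data.List.Relation.Unary.All.Properties as All using (++⁺)
open import Data.List.Relation.Unary.AllPairs using ([]; _∷_)
open import Data.List.Relation.Unary.Any using (here; there)
open import Data.List.Relation.Unary.Unique.Propositional using (Unique)
import Data.List.Relation.Unary.Unique.Propositional.Properties as Unique
open import Data.Nat as ℕ using (ℕ; zero; suc; z≤n; s≤s)
open import Data.Nat.Coprimality using (Coprime; gcd≡1⇒coprime; coprime-Bézout)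
open import Data.Nat.GCD using (module Bézout)
import Data.Nat.Properties as ℕ
open import Data.Product using (∃; ∃₂; _×_; _,_; proj₁; proj₂; uncurry)
open import Data.Sum as Sum using (_⊎_; inj₁; inj₂; [_,_]′)
open import Data.Vec using (_∷_; tabulate; there)
open import Data.Vec.Properties using (lookup∘tabulate; lookup⇒[]=; []=⇒lookup)
open import Function using (_∘_)
open import Function.Definitions using (Injective; Surjective)
open import Level using (0ℓ)
open import Relation.Binary.Core using (Rel)
open import Relation.Binary.PropositionalEquality
  using (_≡_; _≢_; refl; sym; trans; cong; cong₂; subst; setoid; ≢-sym)
open import Relation.Nullary using (Dec; yes; no; ¬_; contradiction; does)
open import Relation.Nullary.Decidable using (map′; _→-dec_; _×-dec_; ¬?; dec-true; recompute)
open import Relation.Unary using (Pred; Decidable)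

open +-*-Solver using (solve; _:=_; _:+_; _:*_; _:-_; :-_; con)

-- Finite subsets, permuted lists and size bounds

x∈p─q⇒x∉q : ∀ {n} {p q : Subset n} {x} → x ∈ p ─ q → x ∉ q
x∈p─q⇒x∉q {p = _ ∷ _} {q = true ∷ _} (there x∈) (there x∈q) = x∈p─q⇒x∉q x∈ x∈q
x∈p─q⇒x∉q {p = _ ∷ _} {q = false ∷ _} (there x∈) (there x∈q) = x∈p─q⇒x∉q x∈ x∈q

module _ {n} {P : Pred (Fin n) 0ℓ} (P? : Decidable P) where

  separate : Subset n
  separate = tabulate (does ∘ P?)

  ∈-separate⁺ : ∀ {x} → P x → x ∈ separate
  ∈-separate⁺ {x} px = lookup⇒[]= x _ (trans (lookup∘tabulate _ x) (dec-true (P? x) px))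

  ∈-separate⁻ : ∀ {x} → x ∈ separate → P x
  ∈-separate⁻ {x} x∈ with P? x | trans (sym (lookup∘tabulate (does ∘ P?) x)) ([]=⇒lookup x∈)
  ... | yes px | _ = px

Unique-resp-↭ : {A : Set} {xs ys : List A} → xs ↭ ys → Unique xs → Unique ys
Unique-resp-↭ {A} p = Permutation.Unique-resp-↭ (setoid A) (↭⇒↭ₛ p)

_∖_ : ∀ {n} → Subset n → Subset n → Pred (Fin n) 0ℓ
(X ∖ Y) v = v ∈ X × v ∉ Y

infix 6 _∖_

-- Chosen so that suc (twice N) is 2 * suc N.
twice : ℕ → ℕ
twice N = N ℕ.+ 1 ℕ.* suc N

-- One breadth-first search costs a factor of two in the number of colours. Each further rib length
-- needs another search inside the base of the previous fan, which must therefore retain size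
-- `twice N`.
fanSize : ℕ → ℕ → ℕ
fanSize zero    N = twice N
fanSize (suc w) N = fanSize w (twice N)

-- The outer `twice` pays for the first of three nested fans, `fanSize` for the second, the inner
-- `twice` for the third.
bridgeSize : ℕ → ℕ → ℕ
bridgeSize w N = twice (fanSize w (twice N))

nestSize : ∀ {m} → (Fin m → ℕ) → ℕ → ℕ
nestSize {zero}  w N = N
nestSize {suc m} w N = bridgeSize (w zero) (nestSize (w ∘ suc) N)

-- Walks and paths in a graph

module _ (H : Graph) where
  open Graph H

  private variable
    x y z u v r : Vertex
    xs ys zs    : List Vertex
    d e         : ℕ
    A B         : Pred Vertex 0ℓ

  -- `Trail x ys z` is a walk from x to z with vertex sequence x ∷ ys.
  data Trail : Vertex → List Vertex → Vertex → Set where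
    []  : Trail x [] x
    _∷_ : Adj x y → Trail y ys z → Trail x (y ∷ ys) z

  _++ᵗ_ : Trail x ys y → Trail y zs z → Trail x (ys ++ zs) z
  []      ++ᵗ q = q
  (a ∷ p) ++ᵗ q = a ∷ (p ++ᵗ q)

  -- The permutation later carries distinctness, membership and length over to the reversed walk.
  reverse : Trail x ys z → ∃ λ zs → Trail z zs x × x ∷ ys ↭ z ∷ zs
  reverse []                        = [] , [] , ↭-refl
  reverse (_∷_ {x = x} a p) with reverse p
  ... | zs , q , perm = zs ∷ʳ x , q ++ᵗ (adj-sym a ∷ []) , ↭-trans (prep x perm) (∷↭∷ʳ x _)

  suffix : x ∈ₗ y ∷ ys → Trail y ys z → Unique (y ∷ ys) →
           ∃ λ zs → Trail x zs z × Unique (x ∷ zs) × (∀ {w} → w ∈ₗ zs → w ∈ₗ ys)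
  suffix (here refl) p uniq = _ , p , uniq , λ w∈ → w∈
  suffix (there x∈) (a ∷ p) (_ ∷ uniq) with suffix x∈ p uniq
  ... | zs , q , uniq′ , zs⊆ = zs , q , uniq′ , there ∘ zs⊆

  -- Loops are first erased from the rest of the walk; if x still occurs there, the walk is cut down
  -- to the part starting at that occurrence.
  eraseLoops : Trail x ys z → ∃ λ zs → Trail x zs z × Unique (x ∷ zs) × (∀ {w} → w ∈ₗ zs → w ∈ₗ ys)
  eraseLoops [] = [] , [] , [] ∷ [] , λ w∈ → w∈
  eraseLoops {x = x} (_∷_ {y = y} a p) with eraseLoops p
  ... | zs , q , uniq , zs⊆ with ∈ₗ-dec _≟_ x (y ∷ zs)
  ...   | no x∉ = y ∷ zs , a ∷ q , All.tabulate (λ { w∈ refl → x∉ w∈ }) ∷ uniq ,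
                  λ { (here refl) → here refl ; (there w∈) → there (zs⊆ w∈) }
  ...   | yes x∈ with suffix x∈ q uniq
  ...     | ws , q′ , uniq′ , ws⊆ = ws , q′ , uniq′ , there ∘ zs⊆ ∘ ws⊆

  -- A path from x to z with d edges, all of whose vertices other than x satisfy A.
  record Route (A : Pred Vertex 0ℓ) (x z : Vertex) (d : ℕ) : Set where
    constructor route
    field
      {after} : List Vertex
      trail   : Trail x after z
      unique  : Unique (x ∷ after)
      within  : All A after
      length≡ : length after ≡ d

    visits : ∀ {w} → w ∈ₗ x ∷ after → w ≡ x ⊎ A w
    visits (here eq)  = inj₁ eq
    visits (there w∈) = inj₂ (All.lookup within w∈)

  weaken : (∀ {w} → A w → B w) → Route A x z d → Route B x z d
  weaken A⊆B (route p uniq in-A len) = route p uniq (All.map A⊆B in-A) len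

  end∈ : Route A x z (suc d) → A z
  end∈ (route (_ ∷ p) _ in-A _) = last p in-A
    where
    last : Trail y ys z → All A (y ∷ ys) → A z
    last []      (az ∷ _) = az
    last (_ ∷ p) (_ ∷ az) = last p az

  cons : Adj y x → A x → Route A x z d → (∀ {w} → w ≡ x ⊎ A w → w ≢ y) → Route A y z (suc d)
  cons a ax p@(route t uniq in-A len) fresh =
    route (a ∷ t) (All.tabulate (λ w∈ → ≢-sym (fresh (Route.visits p w∈))) ∷ uniq) (ax ∷ in-A) (cong suc len)

  append : Route A x y d → Route B y z e → (∀ {w} → w ≡ x ⊎ A w → ¬ B w) →
           Route (λ w → A w ⊎ B w) x z (d ℕ.+ e)
  append p@(route {ys} t uniq in-A len) (route {zs} t′ (_ ∷ uniq′) in-B len′) disjoint = route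
    (t ++ᵗ t′)
    (Unique.++⁺ uniq uniq′ λ (w∈ys , w∈zs) → disjoint (Route.visits p w∈ys) (All.lookup in-B w∈zs))
    (++⁺ (All.map inj₁ in-A) (All.map inj₂ in-B))
    (trans (length-++ ys) (cong₂ ℕ._+_ len len′))

  -- The first path is followed by the reverse of the second. The reversed path starts at r and has
  -- no repetition, so its remaining vertices differ from r, the only possible common vertex. The
  -- region gains v because a route does not constrain its own start.
  meet : Route A u r d → Route B v r e → (∀ {w} → w ≡ u ⊎ A w → w ≡ v ⊎ B w → w ≡ r) →
         Route (λ w → (A w ⊎ B w) ⊎ w ≡ v) u v (d ℕ.+ e)
  meet {r = r} p@(route {ys} t uniq in-A len) q@(route {zs} t′ uniq′ in-B len′) common
    with reverse t′
  ... | ws , s , perm = route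
    (t ++ᵗ s)
    (Unique.++⁺ uniq (uniq-ws uniq-r)
      λ (w∈ys , w∈ws) → r∉ws uniq-r w∈ws (common (Route.visits p w∈ys) (Route.visits q (back w∈ws))))
    (++⁺ (All.map (inj₁ ∘ inj₁) in-A) (All.tabulate ([ inj₂ , inj₁ ∘ inj₂ ]′ ∘ Route.visits q ∘ back)))
    (trans (length-++ ys) (cong₂ ℕ._+_ len (trans (sym (ℕ.suc-injective (↭-length perm))) len′)))
    where
    back : ∀ {w} → w ∈ₗ ws → w ∈ₗ _ ∷ zs
    back w∈ = ∈-resp-↭ (↭-sym perm) (there w∈)
    uniq-r : Unique (r ∷ ws)
    uniq-r = Unique-resp-↭ perm uniq′
    uniq-ws : Unique (r ∷ ws) → Unique ws
    uniq-ws (_ ∷ uniq) = uniq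
    r∉ws : Unique (r ∷ ws) → ∀ {w} → w ∈ₗ ws → w ≢ r
    r∉ws (r≢ ∷ _) w∈ = ≢-sym (All.lookup r≢ w∈)

  -- Colourings, fans and breadth-first search

  Proper : {C : Set} → Subset order → (Vertex → C) → Set
  Proper X c = ∀ u v → u ∈ X → v ∈ X → Adj u v → c u ≢ c v

  Colourable : ℕ → Subset order → Set
  Colourable k X = ∃ λ (c : Vertex → Fin k) → Proper X c

  -- Colourings are enumerated through their codes. The decision lets the search branch on whether a
  -- layer is colourable, and later tells which difference graph is not.
  colourable? : ∀ k X → Dec (Colourable k X)
  colourable? k X = map′
    (λ (i , proper) → finToFun i , proper)
    (λ (c , proper) → funToFin c , λ u v u∈ v∈ uv eq → proper u v u∈ v∈ uv
      (trans (sym (finToFun-funToFin c u)) (trans eq (finToFun-funToFin c v))))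
    (any? λ i → all? λ u → all? λ v →
      (u ∈? X) →-dec (v ∈? X) →-dec adj? u v →-dec ¬? (finToFun i u ≟ finToFun i v))

  -- The shift by one keeps the palette `Fin (suc N)` inhabited, so a default colour `zero` always
  -- exists.
  Large : ℕ → Subset order → Set
  Large N X = ¬ Colourable (suc N) X

  -- The `suc` before `depth` makes every rib nonempty: the root then lies outside `base`, and each
  -- vertex of `base` has a first rib neighbour to step to.
  record Fan (w N : ℕ) (X : Subset order) : Set where
    field
      base  : Subset order
      base⊆ : base ⊆ X
      large : Large N base
      root  : Vertex
      depth : ℕ
      ribs  : ∀ {y} → y ∈ base → ∀ {j} → j ℕ.≤ w → Route (X ∖ base) y root (suc depth ℕ.+ j)

    root∈ : ∀ {y} → y ∈ base → (X ∖ base) root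
    root∈ y∈ = end∈ (ribs y∈ z≤n)

  -- Breadth-first search of X: R is the unexplored part and F the last layer.
  module _ (N : ℕ) (X : Subset order) where

    -- The frontier paths stay among explored vertices, so an unexplored neighbour can be prepended
    -- to one without repeating a vertex. A single d serves the whole frontier.
    Reaches : Subset order → Subset order → Vertex → ℕ → Set
    Reaches R F r d = ∀ {f} → f ∈ F → (X ∖ R) f × Route (X ∖ R) f r d

    -- By `absorbs` no edge from F skips the new layer, which is why parity separates consecutive
    -- layers; `inhabited` makes the search terminate.
    record NextLayer (R F : Subset order) : Set where
      field
        layer     : Subset order
        layer⊆    : layer ⊆ R
        inhabited : Nonempty layer
        absorbs   : ∀ {f v} → f ∈ F → v ∈ R → Adj f v → v ∈ layer
        colour    : Vertex → Fin (suc N)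
        proper    : Proper layer colour
        {root}    : Vertex
        {depth}   : ℕ
        reaches   : Reaches (R ─ layer) layer root depth

    -- The boolean component is the parity of the layer.
    LayerColouring : Subset order → Subset order → Bool → Set
    LayerColouring R F b = ∃ λ (c : Vertex → Bool × Fin (suc N)) →
      Proper R c × (∀ {f v} → f ∈ F → v ∈ R → Adj f v → proj₁ (c v) ≡ b)

    nextLayer : ∀ {R F r d} → R ⊆ X → Reaches R F r d → Fan 0 N X ⊎ ¬ Nonempty R ⊎ NextLayer R F
    nextLayer {R} {F} {r} {d} R⊆X reach = search
      where
      near? : Decidable (λ v → v ∈ R × ∃ λ f → f ∈ F × Adj v f)
      near? v = (v ∈? R) ×-dec any? (λ f → (f ∈? F) ×-dec adj? v f)

      near : Subset order
      near = separate near?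

      near⊆R : near ⊆ R
      near⊆R y∈ = proj₁ (∈-separate⁻ near? y∈)

      absorbs : ∀ {f v} → f ∈ F → v ∈ R → Adj f v → v ∈ near
      absorbs f∈F v∈R fv = ∈-separate⁺ near? (v∈R , _ , f∈F , adj-sym fv)

      extend : ∀ {y} → y ∈ near → Route (X ∖ R) y r (suc d)
      extend y∈ with ∈-separate⁻ near? y∈
      ... | y∈R , f , f∈F , yf = cons yf (proj₁ (reach f∈F)) (proj₂ (reach f∈F))
        λ { (inj₁ refl) refl → proj₂ (proj₁ (reach f∈F)) y∈R ; (inj₂ (_ , w∉R)) refl → w∉R y∈R }

      search : Fan 0 N X ⊎ ¬ Nonempty R ⊎ NextLayer R F
      search with nonempty? near
      search | yes ne with colourable? (suc N) near
      -- A layer that defeats `suc N` colours is the base sought: all its paths back to r have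
      -- length `suc d`.
      ... | no large = inj₁ record
        { base  = near
        ; base⊆ = R⊆X ∘ near⊆R
        ; large = large
        ; root  = r
        ; depth = d
        ; ribs  = λ { y∈ z≤n → subst (Route _ _ _) (sym (ℕ.+-identityʳ (suc d)))
                      (weaken (λ (w∈X , w∉R) → w∈X , w∉R ∘ near⊆R) (extend y∈)) }
        }
      ... | yes (colour , proper) = inj₂ (inj₂ record
        { layer     = near
        ; layer⊆    = near⊆R
        ; inhabited = ne
        ; absorbs   = absorbs
        ; colour    = colour
        ; proper    = proper
        ; reaches   = λ y∈ → (R⊆X (near⊆R y∈) , λ y∈′ → x∈p─q⇒x∉q y∈′ y∈)
                    , weaken (λ (w∈X , w∉R) → w∈X , w∉R ∘ p─q⊆p R near) (extend y∈)
        })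
      search | no empty with nonempty? R
      ... | no R-empty = inj₂ (inj₁ R-empty)
      -- The frontier has no unexplored neighbour, so the search restarts at an arbitrary s, as a
      -- layer with itself as root at depth 0.
      ... | yes (s , s∈R) = inj₂ (inj₂ record
        { layer     = ⁅ s ⁆
        ; layer⊆    = λ v∈ → subst (_∈ R) (sym (x∈⁅y⁆⇒x≡y _ v∈)) s∈R
        ; inhabited = s , x∈⁅x⁆ s
        ; absorbs   = λ f∈F v∈R fv → contradiction (_ , absorbs f∈F v∈R fv) empty
        ; colour    = λ _ → zero
        ; proper    = λ u v u∈ v∈ uv _ →
            adj-irrefl (trans (x∈⁅y⁆⇒x≡y _ u∈) (sym (x∈⁅y⁆⇒x≡y _ v∈))) uv
        ; reaches   = λ y∈ → (subst (_∈ X) (sym (x∈⁅y⁆⇒x≡y _ y∈)) (R⊆X s∈R) , λ y∈′ → x∈p─q⇒x∉q y∈′ y∈)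
                    , subst (λ y → Route _ y s 0) (sym (x∈⁅y⁆⇒x≡y _ y∈)) (route [] ([] ∷ []) [] refl)
        })

    -- Edges inside the layer are handled by `colour`. An edge leaving it ends at a vertex whose
    -- parity `c-near` fixes as `not b`, against b on the layer. Neighbours of F are all in the
    -- layer, hence have parity b.
    addLayer : ∀ {R F} b (L : NextLayer R F) →
               LayerColouring (R ─ NextLayer.layer L) (NextLayer.layer L) (not b) → LayerColouring R F b
    addLayer {R} {F} b L (c , c-proper , c-near) = merged , merged-proper , merged-near
      where
      open NextLayer L

      merged : Vertex → Bool × Fin (suc N)
      merged v with v ∈? layer
      ... | yes _ = b , colour v
      ... | no _  = c v

      merged-proper : Proper R merged
      merged-proper u v u∈ v∈ uv eq with u ∈? layer | v ∈? layer
      ... | yes u∈L | yes v∈L = proper u v u∈L v∈L uv (cong proj₂ eq)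
      ... | yes u∈L | no v∉L  =
        not-¬ refl (trans (cong proj₁ eq) (c-near u∈L (x∈p∧x∉q⇒x∈p─q v∈ v∉L) uv))
      ... | no u∉L  | yes v∈L =
        not-¬ refl (trans (cong proj₁ (sym eq)) (c-near v∈L (x∈p∧x∉q⇒x∈p─q u∈ u∉L) (adj-sym uv)))
      ... | no u∉L  | no v∉L  =
        c-proper u v (x∈p∧x∉q⇒x∈p─q u∈ u∉L) (x∈p∧x∉q⇒x∈p─q v∈ v∉L) uv eq

      merged-near : ∀ {f v} → f ∈ F → v ∈ R → Adj f v → proj₁ (merged v) ≡ b
      merged-near {v = v} f∈F v∈R fv with v ∈? layer
      ... | yes _  = refl
      ... | no v∉L = contradiction (absorbs f∈F v∈R fv) v∉L

    explore : ∀ {R F r d} → Acc _⊂_ R → R ⊆ X → Reaches R F r d → ∀ b → Fan 0 N X ⊎ LayerColouring R F b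
    explore {R} (acc rec) R⊆X reach b with nextLayer R⊆X reach
    ... | inj₁ fan = inj₁ fan
    ... | inj₂ (inj₁ R-empty) = inj₂
      ( (λ _ → b , zero)
      , (λ u _ u∈ → contradiction (u , u∈) R-empty)
      , (λ _ v∈ → contradiction (_ , v∈) R-empty) )
    ... | inj₂ (inj₂ L) = Sum.map₂ (addLayer b L)
      (explore (rec shrinks) (R⊆X ∘ p─q⊆p R layer) reaches (not b))
      where
      open NextLayer L
      shrinks : R ─ layer ⊂ R
      shrinks = p─q⊆p R layer , proj₁ inhabited , layer⊆ (proj₂ inhabited)
              , λ x∈ → x∈p─q⇒x∉q x∈ (proj₂ inhabited)

  fan₀ : ∀ N X → Large (twice N) X → Fan 0 N X
  fan₀ N X large with nonempty? X
  ... | no X-empty = contradiction ((λ _ → zero) , λ u _ u∈ → contradiction (u , u∈) X-empty) large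
  -- The empty frontier makes `Reaches` vacuous, so s and 0 are mere placeholders.
  ... | yes (s , _) with explore N X {F = ∅} {r = s} {d = 0} (⊂-wellFounded X) ⊆-refl (⊥-elim ∘ ∉⊥) false
  ...   | inj₁ fan = fan
  ...   | inj₂ (c , proper , _) = contradiction (code ∘ c , code-proper) large
    where
    bit : Bool → Fin 2
    bit false = zero
    bit true  = suc zero

    bit-injective : ∀ {a b} → bit a ≡ bit b → a ≡ b
    bit-injective {false} {false} _ = refl
    bit-injective {true}  {true}  _ = refl

    code : Bool × Fin (suc N) → Fin (2 ℕ.* suc N)
    code (b , i) = combine (bit b) i

    code-proper : Proper X (code ∘ c)
    code-proper u v u∈ v∈ uv eq with combine-injective _ _ _ _ eq
    ... | same-bit , same-colour = proper u v u∈ v∈ uv (cong₂ _,_ (bit-injective same-bit) same-colour)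

  -- A vertex y of the inner fan has its first rib neighbour y′ in the outer base;
  -- going through y′ lengthens the outer ribs by one.
  lengthen : ∀ {w N N′ X} (outer : Fan w N′ X) → Fan 0 N (Fan.base outer) → Fan (suc w) N X
  lengthen {w} {X = X} outer inner = record
    { base  = Inner.base
    ; base⊆ = Outer.base⊆ ∘ Inner.base⊆
    ; large = Inner.large
    ; root  = Outer.root
    ; depth = Outer.depth
    ; ribs  = ribs
    }
    where
    module Outer = Fan outer
    module Inner = Fan inner

    outside : ∀ {v} → (X ∖ Outer.base) v → (X ∖ Inner.base) v
    outside (v∈X , v∉) = v∈X , v∉ ∘ Inner.base⊆

    ribs : ∀ {y} → y ∈ Inner.base → ∀ {j} → j ℕ.≤ suc w →
           Route (X ∖ Inner.base) y Outer.root (suc Outer.depth ℕ.+ j)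
    ribs y∈ {zero} _ = weaken outside (Outer.ribs (Inner.base⊆ y∈) z≤n)
    ribs y∈ {suc j} (s≤s j≤w) with Inner.ribs y∈ z≤n
    ... | route (yy′ ∷ _) _ ((y′∈ , y′∉) ∷ _) _ =
      subst (Route _ _ _) (sym (ℕ.+-suc (suc Outer.depth) j))
        (cons yy′ (Outer.base⊆ y′∈ , y′∉) (weaken outside (Outer.ribs y′∈ j≤w)) fresh)
      where
      fresh : ∀ {w} → w ≡ _ ⊎ (X ∖ Inner.base) w → w ≢ _
      fresh (inj₁ refl)     refl = y′∉ y∈
      fresh (inj₂ (_ , w∉)) refl = w∉ y∈

  fan : ∀ w N X → Large (fanSize w N) X → Fan w N X
  fan zero    N X large = fan₀ N X large
  fan (suc w) N X large = lengthen outer (fan₀ N (Fan.base outer) (Fan.large outer))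
    where outer = fan w (twice N) X large

  -- Bridges of adjustable length

  Between : (A : Pred Vertex 0ℓ) (u v : Vertex) (d : ℕ) → Set
  Between A u v = Route (λ x → A x ⊎ x ≡ v) u v

  -- The two ribs to the root may cross, so going up one and down the other is only a walk. Erasing
  -- loops loses control of the length, which is harmless: the adjustable part of a bridge lies
  -- elsewhere.
  link : ∀ {N X} (F : Fan 0 N X) {u v} → u ∈ Fan.base F → v ∈ Fan.base F →
         ∃ (Between (X ∖ Fan.base F) u v)
  link {X = X} F {u} {v} u∈ v∈ with Fan.ribs F u∈ z≤n | Fan.ribs F v∈ z≤n
  ... | route {ys} p _ in-p _ | q′@(route q _ _ _) with reverse q
  ...   | ws , s , perm with eraseLoops (p ++ᵗ s)
  ...     | zs , t , uniq , zs⊆ = _ , route t uniq (All.tabulate (region ∘ ∈-++⁻ ys ∘ zs⊆)) refl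
    where
    region : ∀ {w} → w ∈ₗ ys ⊎ w ∈ₗ ws → (X ∖ Fan.base F) w ⊎ w ≡ v
    region (inj₁ w∈) = inj₁ (All.lookup in-p w∈)
    region (inj₂ w∈) = Sum.swap (Route.visits q′ (∈-resp-↭ (↭-sym perm) (there w∈)))

  -- Only the width of the window of lengths is uniform; its start d may depend on the pair of ends.
  record Bridging (w N : ℕ) (X : Subset order) : Set where
    field
      base   : Subset order
      base⊆  : base ⊆ X
      large  : Large N base
      bridge : ∀ {u v} → u ∈ base → v ∈ base → u ≢ v →
               ∃ λ d → ∀ {j} → j ℕ.≤ w → Between (X ∖ base) u v (d ℕ.+ j)

  -- A path from u to v goes up the second fan, whose rib length is free, then through
  -- the first fan to the root of the third one, and down the third fan.
  bridgeFans : ∀ {w N N′ N″ X} (first : Fan 0 N X) (second : Fan w N′ (Fan.base first)) →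
               Fan 0 N″ (Fan.base second) → Bridging w N″ X
  bridgeFans {w} {X = X} first second third = record
    { base   = Third.base
    ; base⊆  = First.base⊆ ∘ Second.base⊆ ∘ Third.base⊆
    ; large  = Third.large
    ; bridge = bridge
    }
    where
    module First  = Fan first
    module Second = Fan second
    module Third  = Fan third

    bridge : ∀ {u v} → u ∈ Third.base → v ∈ Third.base → u ≢ v →
             ∃ λ d → ∀ {j} → j ℕ.≤ w → Between (X ∖ Third.base) u v (d ℕ.+ j)
    bridge {u} {v} u∈ v∈ u≢v
      with r₂∈ , r₂∉ ← Second.root∈ (Third.base⊆ u∈)
         | r₃∈ , r₃∉ ← Third.root∈ v∈
      -- Both roots lie in the base of the first fan, so they can be joined through the part of X
      -- outside that base.
      with dₗ , l ← link first (Second.base⊆ r₃∈) r₂∈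
      = _ , λ {j} j≤w → subst (Route _ u v) (rearrange (suc Second.depth) j _)
          (weaken region (meet (Second.ribs (Third.base⊆ u∈) j≤w) (append (Third.ribs v∈ z≤n) l disjoint) common))
      where
      rearrange : ∀ a j b → a ℕ.+ j ℕ.+ b ≡ a ℕ.+ b ℕ.+ j
      rearrange a j b = trans (ℕ.+-assoc a j b) (trans (cong (a ℕ.+_) (ℕ.+-comm j b)) (sym (ℕ.+-assoc a b j)))

      Down : Pred Vertex 0ℓ
      Down w = (Second.base ∖ Third.base) w ⊎ (X ∖ First.base) w ⊎ w ≡ Second.root

      disjoint : ∀ {w} → w ≡ v ⊎ (Second.base ∖ Third.base) w → ¬ ((X ∖ First.base) w ⊎ w ≡ Second.root)
      disjoint (inj₁ refl)     (inj₁ (_ , ∉1)) = ∉1 (Second.base⊆ (Third.base⊆ v∈))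
      disjoint (inj₁ refl)     (inj₂ refl)     = r₂∉ (Third.base⊆ v∈)
      disjoint (inj₂ (∈2 , _)) (inj₁ (_ , ∉1)) = ∉1 (Second.base⊆ ∈2)
      disjoint (inj₂ (∈2 , _)) (inj₂ refl)     = r₂∉ ∈2

      -- The three stretches run in the successive differences of the chain from X down to
      -- `Third.base`. These are disjoint, so only the junction `Second.root` is shared.
      common : ∀ {w} → w ≡ u ⊎ (First.base ∖ Second.base) w → w ≡ v ⊎ Down w → w ≡ Second.root
      common _               (inj₂ (inj₂ (inj₂ eq)))       = eq
      common (inj₁ refl)     (inj₁ eq)                     = contradiction eq u≢v
      common (inj₁ refl)     (inj₂ (inj₁ (_ , ∉3)))        = contradiction u∈ ∉3
      common (inj₁ refl)     (inj₂ (inj₂ (inj₁ (_ , ∉1)))) = contradiction (Second.base⊆ (Third.base⊆ u∈)) ∉1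
      common (inj₂ (_ , ∉2)) (inj₁ refl)                   = contradiction (Third.base⊆ v∈) ∉2
      common (inj₂ (_ , ∉2)) (inj₂ (inj₁ (∈2 , _)))        = contradiction ∈2 ∉2
      common (inj₂ (∈1 , _)) (inj₂ (inj₂ (inj₁ (_ , ∉1)))) = contradiction ∈1 ∉1

      region : ∀ {w} → ((First.base ∖ Second.base) w ⊎ Down w) ⊎ w ≡ v → (X ∖ Third.base) w ⊎ w ≡ v
      region (inj₂ eq)                                = inj₂ eq
      region (inj₁ (inj₁ (∈1 , ∉2)))                  = inj₁ (First.base⊆ ∈1 , ∉2 ∘ Third.base⊆)
      region (inj₁ (inj₂ (inj₁ (∈2 , ∉3))))           = inj₁ (First.base⊆ (Second.base⊆ ∈2) , ∉3)
      region (inj₁ (inj₂ (inj₂ (inj₁ (∈X , ∉1)))))    = inj₁ (∈X , ∉1 ∘ Second.base⊆ ∘ Third.base⊆)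
      region (inj₁ (inj₂ (inj₂ (inj₂ refl))))         = inj₁ (First.base⊆ r₂∈ , r₂∉ ∘ Third.base⊆)

  bridging : ∀ w N X → Large (bridgeSize w N) X → Bridging w N X
  bridging w N X large = bridgeFans first second (fan₀ N (Fan.base second) (Fan.large second))
    where
    first  = fan₀ (fanSize w (twice N)) X large
    second = fan w (twice N) (Fan.base first) (Fan.large first)

  -- Nested bridges, branch vertices and path interiors

  record Nest {m} (w : Fin m → ℕ) (N : ℕ) (X : Subset order) : Set₁ where
    field
      base     : Subset order
      base⊆    : base ⊆ X
      large    : Large N base
      region   : Fin m → Pred Vertex 0ℓ
      region⊆  : ∀ {k x} → region k x → (X ∖ base) x
      disjoint : ∀ {k l x} → region k x → region l x → k ≡ l
      bridge   : ∀ k {u v} → u ∈ base → v ∈ base → u ≢ v →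
                 ∃ λ d → ∀ {j} → j ℕ.≤ w k → Between (region k) u v (d ℕ.+ j)

  -- The new region is what the outer bridging discards, while all inner regions lie within
  -- `Outer.base`; this gives disjointness.
  nestInside : ∀ {m} {w : Fin (suc m) → ℕ} {N N′ X} (outer : Bridging (w zero) N′ X) →
               Nest (w ∘ suc) N (Bridging.base outer) → Nest w N X
  nestInside {m} {w} {X = X} outer inner = record
    { base     = Inner.base
    ; base⊆    = Outer.base⊆ ∘ Inner.base⊆
    ; large    = Inner.large
    ; region   = region
    ; region⊆  = λ {k} → region⊆ {k}
    ; disjoint = λ {k} {l} → disjoint {k} {l}
    ; bridge   = bridge
    }
    where
    module Outer = Bridging outer
    module Inner = Nest inner

    region : Fin (suc m) → Pred Vertex 0ℓ
    region zero    = X ∖ Outer.base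
    region (suc k) = Inner.region k

    region⊆ : ∀ {k x} → region k x → (X ∖ Inner.base) x
    region⊆ {zero}  (x∈X , x∉) = x∈X , x∉ ∘ Inner.base⊆
    region⊆ {suc k} x∈ with Inner.region⊆ {k} x∈
    ... | x∈O , x∉I = Outer.base⊆ x∈O , x∉I

    disjoint : ∀ {k l x} → region k x → region l x → k ≡ l
    disjoint {zero}  {zero}  _        _        = refl
    disjoint {zero}  {suc l} (_ , x∉) x∈       = contradiction (proj₁ (Inner.region⊆ {l} x∈)) x∉
    disjoint {suc k} {zero}  x∈       (_ , x∉) = contradiction (proj₁ (Inner.region⊆ {k} x∈)) x∉
    disjoint {suc k} {suc l} x∈k      x∈l      = cong suc (Inner.disjoint {k} {l} x∈k x∈l)

    bridge : ∀ k {u v} → u ∈ Inner.base → v ∈ Inner.base → u ≢ v →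
             ∃ λ d → ∀ {j} → j ℕ.≤ w k → Between (region k) u v (d ℕ.+ j)
    bridge (suc k) u∈ v∈ u≢v = Inner.bridge k u∈ v∈ u≢v
    bridge zero    u∈ v∈ u≢v with Outer.bridge (Inner.base⊆ u∈) (Inner.base⊆ v∈) u≢v
    ... | d , routes = d , routes

  nest : ∀ {m} (w : Fin m → ℕ) N X → Large (nestSize w N) X → Nest w N X
  nest {zero} w N X large = record
    { base     = X
    ; base⊆    = ⊆-refl
    ; large    = large
    ; region   = λ ()
    ; region⊆  = λ { {()} }
    ; disjoint = λ { {()} }
    ; bridge   = λ ()
    }
  nest {suc m} w N X large =
    nestInside outer (nest (w ∘ suc) N (Bridging.base outer) (Bridging.large outer))
    where outer = bridging (w zero) (nestSize (w ∘ suc) N) X large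

  -- Remove any vertex s: if the remainder had k colours, a fresh colour for s would give X a
  -- colouring with `suc k`. So one vertex can be chosen and the induction continues.
  pick : ∀ k X → ¬ Colourable k X →
         ∃ λ (φ : Fin k → Vertex) → Injective _≡_ _≡_ φ × (∀ i → φ i ∈ X)
  pick zero    X _ = (λ ()) , (λ { {()} }) , λ ()
  pick (suc k) X uncolourable with nonempty? X
  ... | no X-empty = contradiction ((λ _ → zero) , λ u _ u∈ → contradiction (u , u∈) X-empty) uncolourable
  ... | yes (s , s∈X) with pick k (X ─ ⁅ s ⁆) (uncolourable ∘ colourRest)
    where
    colourRest : Colourable k (X ─ ⁅ s ⁆) → Colourable (suc k) X
    colourRest (c , proper) = c′ , c′-proper
      where
      c′ : Vertex → Fin (suc k)
      c′ v with v ≟ s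
      ... | yes _ = zero
      ... | no _  = suc (c v)

      rest : ∀ {v} → v ∈ X → v ≢ s → v ∈ X ─ ⁅ s ⁆
      rest v∈ v≢s = x∈p∧x∉q⇒x∈p─q v∈ (v≢s ∘ x∈⁅y⁆⇒x≡y _)

      c′-proper : Proper X c′
      c′-proper u v u∈ v∈ uv eq with u ≟ s | v ≟ s
      c′-proper u v u∈ v∈ uv eq | yes refl | yes refl = adj-irrefl refl uv
      c′-proper u v u∈ v∈ uv () | yes _    | no _
      c′-proper u v u∈ v∈ uv () | no _     | yes _
      c′-proper u v u∈ v∈ uv eq | no u≢s   | no v≢s   =
        proper u v (rest u∈ u≢s) (rest v∈ v≢s) uv (Fin.suc-injective eq)
  ...   | φ , φ-injective , φ∈ = φ′ , φ′-injective , φ′∈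
    where
    φ′ : Fin (suc k) → Vertex
    φ′ zero    = s
    φ′ (suc i) = φ i

    s-fresh : ∀ i → φ i ≢ s
    s-fresh i eq = x∈p─q⇒x∉q (φ∈ i) (subst (_∈ ⁅ s ⁆) (sym eq) (x∈⁅x⁆ s))

    φ′-injective : Injective _≡_ _≡_ φ′
    φ′-injective {zero}  {zero}  _  = refl
    φ′-injective {zero}  {suc j} eq = contradiction (sym eq) (s-fresh j)
    φ′-injective {suc i} {zero}  eq = contradiction eq (s-fresh i)
    φ′-injective {suc i} {suc j} eq = cong suc (φ-injective eq)

    φ′∈ : ∀ i → φ′ i ∈ X
    φ′∈ zero    = s∈X
    φ′∈ (suc i) = p─q⊆p X ⁅ s ⁆ (φ∈ i)

  record Interior (A : Pred Vertex 0ℓ) (u v : Vertex) (d : ℕ) : Set where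
    field
      inner   : List Vertex
      trail   : Trail u (inner ∷ʳ v) v
      unique  : Unique inner
      within  : All A inner
      length≡ : suc (length inner) ≡ d

  interior : u ≢ v → Between A u v d → Interior A u v d
  interior u≢v (route [] _ _ _) = contradiction refl u≢v
  interior {v = v} {A = A} _ (route t@(_ ∷ p) (_ ∷ uniq) in-A len) with splitLast p
    where
    splitLast : Trail y ys z → ∃ λ xs → y ∷ ys ≡ xs ∷ʳ z
    splitLast [] = [] , refl
    splitLast {y = y} (_ ∷ p) with splitLast p
    ... | xs , eq = y ∷ xs , cong (y ∷_) eq
  ... | inner , eq with subst (λ zs → Trail _ zs _) eq t | subst Unique eq uniq | subst (All _) eq in-A
  ...   | t′ | uniq′ | in-A′ = record
    { inner   = inner
    ; trail   = t′
    ; unique  = proj₁ (unique-init inner uniq′)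
    -- The region of a `Between` route admits v, but v is already the last vertex, so distinctness
    -- puts every earlier one in A.
    ; within  = All.zipWith (λ { (inj₁ a , _) → a ; (inj₂ refl , ≢v) → contradiction refl ≢v })
                  (All.++⁻ˡ inner in-A′ , proj₂ (unique-init inner uniq′))
    ; length≡ = trans (ℕ.+-comm 1 _) (trans (sym (length-++ inner)) (trans (cong length (sym eq)) len))
    }
    where
    unique-init : ∀ xs → Unique (xs ∷ʳ v) → Unique xs × All (_≢ v) xs
    unique-init []       _           = [] , []
    unique-init (x ∷ xs) (x≢ ∷ uniq) with unique-init xs uniq | All.++⁻ xs x≢
    ... | uniq′ , ≢v | x≢xs , x≢v ∷ [] = x≢xs ∷ uniq′ , x≢v ∷ ≢v

  step-adj : Trail x ys z → ∀ {p} → p ∈ₗ steps (x ∷ ys) → Adj (proj₁ p) (proj₂ p)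
  step-adj (a ∷ _) (here refl) = a
  step-adj (_ ∷ p) (there p∈)  = step-adj p p∈

-- Assembling the subdivision

∈-steps-map : {A B : Set} (f : A → B) → ∀ {x y} xs → (x , y) ∈ₗ steps xs → (f x , f y) ∈ₗ steps (map f xs)
∈-steps-map f (_ ∷ _ ∷ _)  (here refl) = here refl
∈-steps-map f (_ ∷ y ∷ xs) (there p)   = there (∈-steps-map f (y ∷ xs) p)

lookup-injective : {A : Set} (xs : List A) → Unique xs → Injective _≡_ _≡_ (lookup xs)
lookup-injective (_ ∷ _)  _          {zero}  {zero}  _  = refl
lookup-injective (_ ∷ _)  (x≢ ∷ _)   {zero}  {suc j} eq = contradiction eq (All.lookup x≢ (∈-lookup j))
lookup-injective (_ ∷ _)  (x≢ ∷ _)   {suc i} {zero}  eq = contradiction (sym eq) (All.lookup x≢ (∈-lookup i))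
lookup-injective (_ ∷ xs) (_ ∷ uniq) {suc i} {suc j} eq = cong suc (lookup-injective xs uniq eq)

module _ (U : Graph) where
  private
    module U = Graph U
    n = U.order

  -- Pairs of endpoints serve as a finite index set for the edges, as a nest needs.
  slot : Edge U → Fin (n ℕ.* n)
  slot e = combine (Edge.src e) (Edge.tgt e)

  slot-injective : ∀ {e f} → slot e ≡ slot f → e ≡ f
  slot-injective {mkEdge i j _ _} {mkEdge k l _ _} eq with combine-injective i j k l eq
  ... | refl , refl = refl

  src≢tgt : (e : Edge U) → Edge.src e ≢ Edge.tgt e
  src≢tgt (mkEdge i j i<j _) eq = Fin.<-irrefl eq (recompute (i Fin.<? j) i<j)

  atPair : (Edge U → ℕ) → Fin n × Fin n → ℕ
  atPair w (i , j) with i Fin.<? j | U.adj? i j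
  ... | yes i<j | yes ij = w (mkEdge i j i<j ij)
  -- A pair that is not an edge still occupies a slot; it asks for no flexibility.
  ... | yes _   | no _   = 0
  ... | no _    | _      = 0

  atPair-edge : ∀ w e → atPair w (Edge.src e , Edge.tgt e) ≡ w e
  atPair-edge w (mkEdge i j i<j ij) with i Fin.<? j | U.adj? i j
  ... | yes _  | yes _  = refl
  -- The edge proof is irrelevant, so it only yields an irrelevant contradiction; deciding the empty
  -- type makes it usable.
  ... | yes _  | no ¬ij = ⊥-elim (recompute (no λ ()) (¬ij ij))
  ... | no ¬<  | _      = ⊥-elim (recompute (no λ ()) (¬< i<j))

  atSlot : (Edge U → ℕ) → Fin (n ℕ.* n) → ℕ
  atSlot w k = atPair w (remQuot n k)

  atSlot-slot : ∀ w e → atSlot w (slot e) ≡ w e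
  atSlot-slot w e = trans (cong (atPair w) (remQuot-combine (Edge.src e) (Edge.tgt e))) (atPair-edge w e)

  subdivisionSize : (Edge U → ℕ) → ℕ
  subdivisionSize w = nestSize (atSlot w) n

  module _ {H : Graph} {w : Edge U → ℕ} {N X} (I : Nest H (atSlot w) N X)
           (φ : Fin n → Graph.Vertex H) (φ-injective : Injective _≡_ _≡_ φ) (φ∈ : ∀ i → φ i ∈ Nest.base I) where
    open Nest I

    private
      ends≢ : ∀ e → φ (Edge.src e) ≢ φ (Edge.tgt e)
      ends≢ e = src≢tgt e ∘ φ-injective

      routes : ∀ e → ∃ λ d → ∀ {j} → j ℕ.≤ atSlot w (slot e) →
               Between H (region (slot e)) (φ (Edge.src e)) (φ (Edge.tgt e)) (d ℕ.+ j)
      routes e = bridge (slot e) (φ∈ _) (φ∈ _) (ends≢ e)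

    offset : Edge U → ℕ
    offset e = proj₁ (routes e)

    module _ (j : Edge U → ℕ) (j≤w : ∀ e → j e ℕ.≤ w e) where
      private
        path : ∀ e → Interior H (region (slot e)) (φ (Edge.src e)) (φ (Edge.tgt e)) (offset e ℕ.+ j e)
        path e = interior H (ends≢ e) (proj₂ (routes e) (subst (j e ℕ.≤_) (sym (atSlot-slot w e)) (j≤w e)))

        module Path e = Interior (path e)

        ℓ : Edge U → ℕ
        ℓ e = length (Path.inner e)

        to : SubdivVertex U ℓ → Graph.Vertex H
        to (inj₁ i)       = φ i
        to (inj₂ (e , i)) = lookup (Path.inner e) i

        to∈region : ∀ e i → region (slot e) (to (inj₂ (e , i)))
        to∈region e i = All.lookup (Path.within e) (∈-lookup i)

        -- Branch vertices lie in `base` and interior ones outside it; two interior vertices with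
        -- the same image share a region, hence an edge of U.
        to-injective : Injective _≡_ _≡_ to
        to-injective {inj₁ i}       {inj₁ k}       eq = cong inj₁ (φ-injective eq)
        to-injective {inj₁ i}       {inj₂ (e , k)} eq =
          contradiction (subst (_∈ base) eq (φ∈ i)) (proj₂ (region⊆ {slot e} (to∈region e k)))
        to-injective {inj₂ (e , k)} {inj₁ i}       eq =
          contradiction (subst (_∈ base) (sym eq) (φ∈ i)) (proj₂ (region⊆ {slot e} (to∈region e k)))
        to-injective {inj₂ (e , i)} {inj₂ (f , k)} eq
          with slot-injective {e} {f} (disjoint {slot e} {slot f} (to∈region e i)
                 (subst (region (slot f)) (sym eq) (to∈region f k)))
        ... | refl = cong (λ i → inj₂ (e , i)) (lookup-injective (Path.inner e) (Path.unique e) eq)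

        branch-image : ∀ e → map to (branch U ℓ e) ≡ φ (Edge.src e) ∷ Path.inner e ∷ʳ φ (Edge.tgt e)
        branch-image e = cong (φ (Edge.src e) ∷_) (trans (map-++ to (internal U ℓ e) _)
          (cong (_∷ʳ φ (Edge.tgt e)) (trans (sym (map-∘ (allFin (ℓ e))))
            (trans (map-tabulate (λ i → i) (lookup (Path.inner e))) (tabulate-lookup (Path.inner e))))))

        branch-adj : ∀ e {x y} → (x , y) ∈ₗ steps (branch U ℓ e) → Graph.Adj H (to x) (to y)
        branch-adj e {x} {y} xy∈ = step-adj H (Path.trail e)
          (subst (λ xs → (to x , to y) ∈ₗ steps xs) (branch-image e) (∈-steps-map to (branch U ℓ e) xy∈))

      subdivisionIn : SubdivisionIn U H
      subdivisionIn = record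
        { ℓ = ℓ
        ; embedding = record
          { to        = to
          ; injective = to-injective
          ; preserves = λ { (e , inj₁ xy∈) → branch-adj e xy∈
                          ; (e , inj₂ yx∈) → Graph.adj-sym H (branch-adj e yx∈) }
          }
        }

      subdivisionIn-length : ∀ e → length (SubdivisionIn.branchingPath subdivisionIn e) ≡ suc (offset e ℕ.+ j e)
      subdivisionIn-length e = trans (cong length (branch-image e)) (cong suc
        (trans (length-++ (Path.inner e)) (trans (ℕ.+-comm _ 1) (Path.length≡ e))))

  -- The offsets d are fixed before j is chosen, so j may be tuned to d. The extra `suc` appears
  -- because vertices, not edges, are counted.
  flexibleSubdivision : ∀ {H} (w : Edge U → ℕ) → Large H (subdivisionSize w) full →
    ∃ λ (d : Edge U → ℕ) → (j : Edge U → ℕ) → (∀ e → j e ℕ.≤ w e) →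
    ∃ λ (S : SubdivisionIn U H) → ∀ e → length (SubdivisionIn.branchingPath S e) ≡ suc (d e ℕ.+ j e)
  flexibleSubdivision {H} w large = fromNest (nest H (atSlot w) n full large)
    where
    fromNest : Nest H (atSlot w) n full → _
    fromNest I with pick H (suc n) (Nest.base I) (Nest.large I)
    -- `Large n` rules out `suc n` colours and so yields `suc n` vertices, one more than U needs;
    -- the first is dropped.
    ... | φ , φ-injective , φ∈ =
        offset I (φ ∘ suc) (Fin.suc-injective ∘ φ-injective) (φ∈ ∘ suc)
      , λ j j≤w → subdivisionIn I (φ ∘ suc) (Fin.suc-injective ∘ φ-injective) (φ∈ ∘ suc) j j≤w
                , subdivisionIn-length I (φ ∘ suc) (Fin.suc-injective ∘ φ-injective) (φ∈ ∘ suc) j j≤w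

-- Modular inverses and residues

inverseℕ : ∀ {m n} → Coprime m n → ∃₂ λ x y → + m * x ≡ 1ℤ + y * + n
inverseℕ {m} {n} coprime with coprime-Bézout coprime
... | Bézout.+- x y eq = + x , + y ,
  trans (trans (ℤ.*-comm (+ m) (+ x)) (trans (sym (ℤ.pos-* x m)) (cong +_ (sym eq))))
        (cong (λ z → 1ℤ + z) (ℤ.pos-* y n))
... | Bézout.-+ x y eq = - + x , - + y , negated (+ m) (+ n) (+ x) (+ y)
  (trans (cong (λ z → 1ℤ + z) (sym (ℤ.pos-* x m))) (trans (cong +_ eq) (ℤ.pos-* y n)))
  where
  negated : ∀ m n x y → 1ℤ + x * m ≡ y * n → m * - x ≡ 1ℤ + (- y) * n
  negated m n x y eq = trans
    (solve 2 (λ m x → m :* (:- x) := con 1ℤ :- (con 1ℤ :+ x :* m)) refl m x)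
    (trans (cong (λ z → 1ℤ - z) eq) (solve 2 (λ n y → con 1ℤ :- y :* n := con 1ℤ :+ (:- y) :* n) refl n y))

inverse : ∀ a n → gcd a (+ n) ≡ 1ℤ → ∃₂ λ x y → a * x ≡ 1ℤ + y * + n
inverse a n gcd≡1 with inverseℕ {∣ a ∣} {n} (gcd≡1⇒coprime (ℤ.+-injective gcd≡1)) | ℤ.+∣i∣≡i⊎+∣i∣≡-i a
... | x , y , eq | inj₁ same    = x , y , trans (cong (_* x) (sym same)) eq
... | x , y , eq | inj₂ flipped = - x , y , trans (solve 2 (λ a x → a :* (:- x) := (:- a) :* x) refl a x)
                                   (trans (cong (_* x) (sym flipped)) eq)

-- j is the remainder of r a⁻¹ − d modulo q.
hitResidue : ∀ a r q → + 2 ≤ q → gcd a q ≡ 1ℤ → ∀ d →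
             ∃ λ j → j ℕ.≤ ∣ q ∣ × a * + (d ℕ.+ j) ≡ r [mod q ]
hitResidue a r (+ suc m) (+≤+ _) gcd≡1 d with inverse a (suc m) gcd≡1
... | x , y , ax≡1 = j , ℕ.<⇒≤ (n%ℕd<d t (suc m)) , ∣⇒∣ᵤ (divides (r * y - a * k) equation)
  where
  n = + suc m
  t = r * x - + d
  j = t %ℕ suc m
  k = t /ℕ suc m

  equation : a * + (d ℕ.+ j) - r ≡ (r * y - a * k) * n
  -- Replace j by t - k n, then a x by 1 + y n: the left side becomes r (a x) - a k n - r, a
  -- multiple of n.
  equation = trans (cong (λ s → a * s - r) (ℤ.pos-+ d j))
    (trans (solve 6 (λ a d j k n r → a :* (d :+ j) :- r := a :* (d :+ ((j :+ k :* n) :- k :* n)) :- r) refl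
              a (+ d) (+ j) k n r)
    (trans (cong (λ s → a * (+ d + (s - k * n)) - r) (sym (a≡a%ℕn+[a/ℕn]*n t (suc m))))
    (trans (solve 6 (λ a d k n r x → a :* (d :+ ((r :* x :- d) :- k :* n)) :- r
                     := r :* (a :* x) :- a :* k :* n :- r) refl a (+ d) k n r x)
    (trans (cong (λ s → r * s - a * k * n - r) ax≡1)
      (solve 5 (λ a k n r y → r :* (con 1ℤ :+ y :* n) :- a :* k :* n :- r := (r :* y :- a :* k) :* n) refl
        a k n r y)))))

-- Counting edges along a walk

All-steps : {A : Set} {P : Pred A 0ℓ} {xs : List A} → All P xs → All (λ (x , y) → P x × P y) (steps xs)
All-steps []               = []
All-steps (_ ∷ [])         = []
All-steps (px ∷ py ∷ pxs) = (px , py) ∷ All-steps (py ∷ pxs)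

All-steps-map : {A B : Set} {R : Rel B 0ℓ} (f : A → B) (xs : List A) →
                (∀ {x y} → (x , y) ∈ₗ steps xs → R (f x) (f y)) → All (uncurry R) (steps (map f xs))
All-steps-map f []           _   = []
All-steps-map f (_ ∷ [])     _   = []
All-steps-map f (x ∷ y ∷ xs) rel = rel (here refl) ∷ All-steps-map f (y ∷ xs) (rel ∘ there)

length-steps : {A : Set} (xs : List A) {k : ℕ} → length xs ≡ suc k → length (steps xs) ≡ k
length-steps (_ ∷ [])     refl = refl
length-steps (_ ∷ y ∷ xs) refl = cong suc (length-steps (y ∷ xs) refl)

length-filter-⇔ : {A : Set} {P Q : Pred A 0ℓ} (P? : Decidable P) (Q? : Decidable Q) {xs : List A} →
                  All (λ x → (P x → Q x) × (Q x → P x)) xs →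
                  length (filter P? xs) ≡ length (filter Q? xs)
length-filter-⇔ P? Q? [] = refl
length-filter-⇔ P? Q? {x ∷ _} ((p⇒q , q⇒p) ∷ iffs) with P? x | Q? x
... | yes _ | yes _ = cong suc (length-filter-⇔ P? Q? iffs)
... | yes p | no ¬q = contradiction (p⇒q p) ¬q
... | no ¬p | yes q = contradiction (q⇒p q) ¬p
... | no _  | no _  = length-filter-⇔ P? Q? iffs

-- Difference graphs and balanced partitions

difference : (G : Graph) (B B′ : EdgeSet G) → Graph
difference G B B′ = record
  { order  = Graph.order G
  ; simple = record
    { Adj        = λ u v → EdgeSet.Mem B u v × ¬ EdgeSet.Mem B′ u v
    ; adj-sym    = λ (uv∈ , uv∉) → EdgeSet.mem-sym B uv∈ , uv∉ ∘ EdgeSet.mem-sym B′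
    ; adj-irrefl = λ u≡v (uv∈ , _) → Graph.adj-irrefl G u≡v (EdgeSet.mem⇒adj B uv∈)
    }
  ; adj?   = λ u v → EdgeSet.mem? B u v ×-dec ¬? (EdgeSet.mem? B′ u v)
  }

-- Partitions must have nonempty parts, so missed colours are punched out one at a time; the fibres
-- stay as fine as those of c.
compress : ∀ {n} k (c : Fin n → Fin k) → ∃₂ λ j (c′ : Fin n → Fin j) →
           j ℕ.≤ k × Surjective _≡_ _≡_ c′ × (∀ {u v} → c′ u ≡ c′ v → c u ≡ c v)
compress zero    c = 0 , c , z≤n , (λ ()) , λ eq → eq
compress (suc k) c with any? (λ i → ¬? (any? λ u → c u ≟ i))
... | yes (i , missed) with compress k (λ u → punchOut {i = i} {c u} (λ eq → missed (u , sym eq)))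
...   | j , c′ , j≤k , onto , fibres =
        j , c′ , ℕ.m≤n⇒m≤1+n j≤k , onto , λ eq → punchOut-injective {i = i} _ _ (fibres eq)
compress (suc k) c | no none-missed = suc k , c , ℕ.≤-refl , onto , λ eq → eq
  where
  onto : Surjective _≡_ _≡_ c
  onto i with any? (λ u → c u ≟ i)
  ... | yes (u , eq) = u , λ { refl → eq }
  ... | no missed    = contradiction (i , missed) none-missed

module _ (G : Graph) (B₁ B₂ : EdgeSet G) where
  open EdgeSet

  -- In the product colouring, a pair in one part cannot be an edge of either difference graph, so
  -- it belongs to both edge sets or to neither. Cycles inside a part are thus balanced edge by
  -- edge.
  balancedPartition : ∀ {k l} → Colourable (difference G B₁ B₂) k full → Colourable (difference G B₂ B₁) l full →
                      ∃ λ j → j ℕ.≤ k ℕ.* l × BalancedPartition G B₁ B₂ j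
  balancedPartition {k} {l} (c₁ , proper₁) (c₂ , proper₂) with compress (k ℕ.* l) (λ v → combine (c₁ v) (c₂ v))
  ... | j , part , j≤kl , onto , fibres = j , j≤kl , record
    { part     = part
    ; nonempty = onto
    ; balanced = λ { i (C , v∈i@(start∈i ∷ _) , unbalanced) → unbalanced
        (length-filter-⇔ (uncurry (mem? B₁)) (uncurry (mem? B₂))
          (All.map (λ (u∈i , v∈i) → sameClass (trans u∈i (sym v∈i)))
            (All-steps (++⁺ v∈i (start∈i ∷ []))))) }
    }
    where
    sameClass : ∀ {u v} → part u ≡ part v → (Mem B₁ u v → Mem B₂ u v) × (Mem B₂ u v → Mem B₁ u v)
    sameClass {u} {v} eq with combine-injective (c₁ u) (c₂ u) (c₁ v) (c₂ v) (fibres eq)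
    ... | eq₁ , eq₂ = to , from
      where
      to : Mem B₁ u v → Mem B₂ u v
      to uv∈ with mem? B₂ u v
      ... | yes uv∈′ = uv∈′
      ... | no uv∉   = contradiction eq₁ (proper₁ u v ∈⊤ ∈⊤ (uv∈ , uv∉))
      from : Mem B₂ u v → Mem B₁ u v
      from uv∈ with mem? B₁ u v
      ... | yes uv∈′ = uv∈′
      ... | no uv∉   = contradiction eq₂ (proper₂ u v ∈⊤ ∈⊤ (uv∈ , uv∉))

  uncolourableDifference : ∀ k {m} → Isμ* G B₁ B₂ m → k ℕ.* k ℕ.< m →
    ¬ Colourable (difference G B₁ B₂) k full ⊎ ¬ Colourable (difference G B₂ B₁) k full
  uncolourableDifference k isμ* k²<m
    with colourable? (difference G B₁ B₂) k full | colourable? (difference G B₂ B₁) k full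
  ... | no ¬col₁ | _        = inj₁ ¬col₁
  ... | yes _    | no ¬col₂ = inj₂ ¬col₂
  ... | yes col₁ | yes col₂ with balancedPartition col₁ col₂
  ...   | j , j≤k² , partition =
          contradiction (ℕ.≤-trans (Isμ*.minimal isμ* j partition) j≤k²) (ℕ.<⇒≱ k²<m)

-- Subdivisions with prescribed residues

module _ {U G : Graph} (B B′ : EdgeSet G) (S : SubdivisionIn U (difference G B B′)) where
  open SubdivisionIn S
  open Embedding embedding

  includeDifference : SubdivisionIn U G
  includeDifference = record
    { ℓ = ℓ
    ; embedding = record
      { to        = to
      ; injective = injective
      ; preserves = λ xy → EdgeSet.mem⇒adj B (proj₁ (preserves xy))
      }
    }

  private
    steps∈ : ∀ e → All (uncurry (Graph.Adj (difference G B B′))) (steps (branchingPath e))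
    steps∈ e = All-steps-map to (branch U ℓ e) (λ xy∈ → preserves (e , inj₁ xy∈))

  count-inside : ∀ e {k} → length (branchingPath e) ≡ suc k → ∣E branchingPath e ∩ B ∣ ≡ k
  count-inside e len = trans
    (cong length (filter-all (uncurry (EdgeSet.mem? B)) (All.map proj₁ (steps∈ e))))
    (length-steps (branchingPath e) len)

  count-outside : ∀ e → ∣E branchingPath e ∩ B′ ∣ ≡ 0
  count-outside e = cong length (filter-none (uncurry (EdgeSet.mem? B′)) (All.map proj₂ (steps∈ e)))

-- All edges of B ∖ B′ contribute the same unit a to the congruence.
congruentSubdivision : ∀ {U} (a r q : Edge U → ℤ) → (∀ e → + 2 ≤ q e) → (∀ e → gcd (a e) (q e) ≡ 1ℤ) →
  ∀ {G} (B B′ : EdgeSet G) → Large (difference G B B′) (subdivisionSize U (λ e → ∣ q e ∣)) full →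
  ∃ λ (S : SubdivisionIn U G) → ∀ e →
    let P = SubdivisionIn.branchingPath S e in
    (a e * + ∣E P ∩ B ∣ ≡ r e [mod q e ]) × ∣E P ∩ B′ ∣ ≡ 0
congruentSubdivision {U} a r q 2≤q coprime B B′ large
  = choose (flexibleSubdivision U (λ e → ∣ q e ∣) large)
  where
  choose : ∃ (λ (d : Edge U → ℕ) → (j : Edge U → ℕ) → (∀ e → j e ℕ.≤ ∣ q e ∣) →
             ∃ λ (S : SubdivisionIn U (difference _ B B′)) →
             ∀ e → length (SubdivisionIn.branchingPath S e) ≡ suc (d e ℕ.+ j e)) → _
  choose (d , flexible) = includeDifference B B′ S , λ e →
      subst (λ k → a e * + k ≡ r e [mod q e ]) (sym (count-inside B B′ S e (lengths e)))
        (proj₂ (proj₂ (hit e)))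
    , count-outside B B′ S e
    where
    hit : ∀ e → ∃ λ j → j ℕ.≤ ∣ q e ∣ × a e * + (d e ℕ.+ j) ≡ r e [mod q e ]
    hit e = hitResidue (a e) (r e) (q e) (2≤q e) (coprime e) (d e)

    chosen  = flexible (proj₁ ∘ hit) (proj₁ ∘ proj₂ ∘ hit)
    S       = proj₁ chosen
    lengths = proj₂ chosen

corollary4p6 : (U : Graph) (a b r q : Edge U → ℤ) →
    (∀ e → + 2 ≤ q e) →
    (∀ e → gcd (a e) (q e) ≡ 1ℤ) →
    (∀ e → gcd (b e) (q e) ≡ 1ℤ) →
    ∃ λ (M : ℤ) →
    (G : Graph) (B₁ B₂ : EdgeSet G) (m : ℕ) →
    Isμ* G B₁ B₂ m → M ≤ + m →
    ∃ λ (S : SubdivisionIn U G) → ∀ e →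
    let P = SubdivisionIn.branchingPath S e in
    a e * + ∣E P ∩ B₁ ∣ + b e * + ∣E P ∩ B₂ ∣ ≡ r e [mod q e ]
corollary4p6 U a b r q 2≤q gcd-a gcd-b = + suc (K ℕ.* K) , λ G B₁ B₂ m isμ* M≤m →
  [ (λ large → addʳ G B₁ B₂ (congruentSubdivision a r q 2≤q gcd-a B₁ B₂ large))
  -- Here the branching paths lie in the second set, so b takes over as the unit and the first count
  -- vanishes.
  , (λ large → addˡ G B₁ B₂ (congruentSubdivision b r q 2≤q gcd-b B₂ B₁ large))
  ]′ (uncolourableDifference G B₁ B₂ K isμ* (ℤ.drop‿+≤+ M≤m))
  where
  -- The `suc` matches the shift in `Large`. If both differences had K colours, at most `K * K`
  -- parts would suffice, so M is one above that.
  K = suc (subdivisionSize U (λ e → ∣ q e ∣))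

  absorbʳ : ∀ a b {k l} → l ≡ 0 → a * + k + b * + l ≡ a * + k
  absorbʳ a b {k} refl = trans (cong (λ z → a * + k + z) (ℤ.*-zeroʳ b)) (ℤ.+-identityʳ _)

  addʳ : ∀ G (B₁ B₂ : EdgeSet G) → _ → ∃ λ (S : SubdivisionIn U G) → ∀ e →
    let P = SubdivisionIn.branchingPath S e in
    a e * + ∣E P ∩ B₁ ∣ + b e * + ∣E P ∩ B₂ ∣ ≡ r e [mod q e ]
  addʳ G B₁ B₂ (S , hits) = S , λ e →
    subst (λ s → s ≡ r e [mod q e ]) (sym (absorbʳ (a e) (b e) (proj₂ (hits e)))) (proj₁ (hits e))

  addˡ : ∀ G (B₁ B₂ : EdgeSet G) → _ → ∃ λ (S : SubdivisionIn U G) → ∀ e →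
    let P = SubdivisionIn.branchingPath S e in
    a e * + ∣E P ∩ B₁ ∣ + b e * + ∣E P ∩ B₂ ∣ ≡ r e [mod q e ]
  addˡ G B₁ B₂ (S , hits) = S , λ e →
    subst (λ s → s ≡ r e [mod q e ])
      (sym (trans (ℤ.+-comm (a e * _) _) (absorbʳ (b e) (a e) (proj₂ (hits e))))) (proj₁ (hits e))
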